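{- Let $n\geq 5$ be an integer, let $W_n$ be the wheel graph on $n$ vertices, and let $W_n-e$ be the subgraph obtained from $W_n$ by deleting an edge $e$ which lies on the cycle. Let $B_n=\begin{bmatrix}0&\mathbf{e}'\\ \mathbf{e}&T_{n-1}\end{bmatrix}$ be the $n\times n$ matrix in which $\mathbf{e}\in\mathbb{R}^{n-1}$ is the all-ones column vector and $T_{n-1}$ is the $(n-1)\times(n-1)$ tridiagonal matrix all of whose diagonal, superdiagonal and subdiagonal entries equal $-2$. Then $$\det(E(W_n-e))=\det(B_n)=\begin{cases}0 & \text{if } n\equiv 0\pmod 3,\\ 2^{n-2}\left(\frac{n-1}{3}\right) & \text{if } n\equiv 1\pmod 3,\\ -2^{n-2}\left(\frac{n+1}{3}\right) & \text{if } n\equiv 2\pmod 3,\end{cases}$$ where $E(W_n-e)$ is the eccentricity matrix of $W_n-e$.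
   Context: The prime denotes transpose. For a simple connected graph $G$ with vertices $v_1,\dots,v_n$, let $d(v_i,v_j)$ be the length of a shortest path between $v_i$ and $v_j$, and let $e(v_i)=\max\{d(v_i,v_j):1\le j\le n\}$ be the eccentricity of $v_i$. The eccentricity matrix $E(G)$ is the $n\times n$ real matrix with $(E(G))_{ij}=d(v_i,v_j)$ if $d(v_i,v_j)=\min\{e(v_i),e(v_j)\}$, and $(E(G))_{ij}=0$ otherwise (distances and eccentricities computed in $G$). The wheel graph $W_n$ is the graph on $n$ vertices consisting of a cycle of length $n-1$ together with one further vertex (the hub) adjacent to every vertex of the cycle. The vertices are labelled so that $v_1$ is the hub and $v_2,\dots,v_n$ are the cycle vertices in cyclic order. -}

module Defs where

import Algebra.Properties.Monoid.Sum
open import Data.Bool.Base using (if_then_else_)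
open import Data.Empty using (⊥)
open import Data.Fin.Base using (Fin; zero; suc; toℕ; punchIn)
open import Data.Fin.Properties using (_≟_; any?; 0≢1+n; suc-injective)
open import Data.Integer.Base using (ℤ; +_; -_; 0ℤ; 1ℤ; -1ℤ; _*_; _^_)
open import Data.Integer.Properties using (+-0-monoid)
open import Data.List.Base using (List; []; _∷_; [_]; tabulate)
open import Data.List.Extrema.Nat using (max)
open import Data.List.Relation.Unary.All using ([]; _∷_)
open import Data.List.Relation.Unary.AllPairs using ([]; _∷_)
open import Data.List.Relation.Unary.Unique.Propositional using (Unique)
import Data.List.Relation.Unary.Unique.DecPropositional as DecUnique
open import Data.Nat.Base using (ℕ; zero; suc; _<_; _⊓_; ∣_-_∣; s<s⁻¹)
import Data.Nat.Properties as ℕ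
open import Data.Product.Base using (Σ; ∃; _×_; _,_; proj₁; proj₂)
open import Data.Sum.Base using (_⊎_; inj₁; inj₂; swap)
open import Data.Unit.Base using (⊤; tt)
open import Function.Base using (_∘_)
open import Relation.Binary.Definitions using (Symmetric; Irreflexive) renaming (Decidable to Decidable₂)
open import Relation.Binary.PropositionalEquality.Core using (_≡_; _≢_; refl; sym)
open import Relation.Nullary.Decidable.Core using (Dec; yes; no; ⌊_⌋; map′; _×-dec_; _⊎-dec_; ¬?)
open import Relation.Nullary.Negation.Core using (¬_)
open import Relation.Unary using (Pred; Decidable)
open import Level using (0ℓ)

-- Every matrix occurring here has integer entries, and the determinant is a
-- polynomial with integer coefficients in the entries, so ℤ replaces ℝ.
Matrix : ℕ → Set
Matrix n = Fin n → Fin n → ℤ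

open Algebra.Properties.Monoid.Sum +-0-monoid using (sum)

-- Laplace expansion along the first row.
det : ∀ {n} → Matrix n → ℤ
det {zero}  A = 1ℤ
det {suc n} A =
  sum λ j → -1ℤ ^ toℕ j * A zero j * det (λ i k → A (suc i) (punchIn j k))

record SimpleGraph (n : ℕ) : Set₁ where
  field
    Adj        : Fin n → Fin n → Set
    adj?       : Decidable₂ Adj
    adj-sym    : Symmetric Adj
    adj-irrefl : Irreflexive _≡_ Adj

-- The pair (a , b) stands for the unordered pair {a , b}.
SameEdge : ∀ {n} → (a b u v : Fin n) → Set
SameEdge a b u v = (u ≡ a × v ≡ b) ⊎ (u ≡ b × v ≡ a)

deleteEdge : ∀ {n} → SimpleGraph n → (a b : Fin n) → SimpleGraph n
deleteEdge G a b = record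
  { Adj        = λ u v → Adj u v × ¬ SameEdge a b u v
  ; adj?       = λ u v → adj? u v ×-dec
                   ¬? (((u ≟ a) ×-dec (v ≟ b)) ⊎-dec ((u ≟ b) ×-dec (v ≟ a)))
  ; adj-sym    = λ (uv , ne) → adj-sym uv , λ
                   { (inj₁ (p , q)) → ne (inj₂ (q , p))
                   ; (inj₂ (p , q)) → ne (inj₁ (q , p)) }
  ; adj-irrefl = λ eq (uv , _) → adj-irrefl eq uv
  }
  where open SimpleGraph G

least : {P : Pred ℕ 0ℓ} → Decidable P → ∀ k → P k →
        ∃ λ m → P m × (∀ j → j < m → ¬ P j)
least P? zero    p = zero , p , λ _ ()
least P? (suc k) p with P? zero
... | yes p₀ = zero , p₀ , λ _ ()
... | no ¬p₀ with m , pm , below ← least (P? ∘ suc) k p =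
  suc m , pm , λ { zero _ → ¬p₀ ; (suc j) j<m → below j (s<s⁻¹ j<m) }

module _ {n : ℕ} (G : SimpleGraph n) where
  open SimpleGraph G

  data Walk : Fin n → Fin n → ℕ → Set where
    nil  : ∀ {u} → Walk u u 0
    cons : ∀ {u w v k} → Adj u w → Walk w v k → Walk u v (suc k)

  vertices : ∀ {u v k} → Walk u v k → List (Fin n)
  vertices {u} nil        = [ u ]
  vertices {u} (cons _ p) = u ∷ vertices p

  Path : Fin n → Fin n → ℕ → Set
  Path u v k = Σ (Walk u v k) λ p → Unique (vertices p)

  Connected : Set
  Connected = ∀ u v → ∃ λ k → Path u v k

  walkWith? : {P : Pred (List (Fin n)) 0ℓ} → Decidable P →
              ∀ u v k → Dec (Σ (Walk u v k) λ p → P (vertices p))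
  walkWith? P? u v zero with u ≟ v
  ... | no u≢v   = no λ { (nil , _) → u≢v refl }
  ... | yes refl = map′ (nil ,_) (λ { (nil , p) → p }) (P? [ u ])
  walkWith? P? u v (suc k) =
    map′ (λ { (w , uw , p , h) → cons uw p , h })
         (λ { (cons uw p , h) → _ , uw , p , h })
         (any? λ w → adj? u w ×-dec walkWith? (P? ∘ (u ∷_)) w v k)

  path? : ∀ u v k → Dec (Path u v k)
  path? = walkWith? (DecUnique.unique? _≟_)

  module _ (conn : Connected) where

    dist : Fin n → Fin n → ℕ
    dist u v = proj₁ (least (path? u v) _ (proj₂ (conn u v)))

    ecc : Fin n → ℕ
    ecc u = max 0 (tabulate (dist u))

    eccMatrix : Matrix n
    eccMatrix u v =
      if ⌊ dist u v ℕ.≟ ecc u ⊓ ecc v ⌋ then + dist u v else 0ℤ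

Next : ∀ {m} → Fin m → Fin m → Set
Next {m} i j = suc (toℕ i) ≡ toℕ j ⊎ (suc (toℕ i) ≡ m × toℕ j ≡ 0)

-- The condition i ≢ j is only needed to exclude a loop when m = 1.
CycleAdj : ∀ {m} → Fin m → Fin m → Set
CycleAdj i j = i ≢ j × (Next i j ⊎ Next j i)

cycleAdj? : ∀ {m} → Decidable₂ (CycleAdj {m})
cycleAdj? i j = ¬? (i ≟ j) ×-dec (next? i j ⊎-dec next? j i)
  where
  next? : ∀ {m} → Decidable₂ (Next {m})
  next? {m} i j = (suc (toℕ i) ℕ.≟ toℕ j) ⊎-dec
                  ((suc (toℕ i) ℕ.≟ m) ×-dec (toℕ j ℕ.≟ 0))

-- Vertex zero is the hub; suc i is the i-th vertex of the rim cycle.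
-- Intended for n ≥ 4, where the rim is a genuine cycle of length n - 1.
WheelAdj : ∀ {n} → Fin n → Fin n → Set
WheelAdj zero    zero    = ⊥
WheelAdj zero    (suc _) = ⊤
WheelAdj (suc _) zero    = ⊤
WheelAdj (suc i) (suc j) = CycleAdj i j

wheel : ∀ n → SimpleGraph n
wheel n = record
  { Adj = WheelAdj ; adj? = dec ; adj-sym = λ {u} {v} → symm u v
  ; adj-irrefl = λ { {u} refl → irr u } }
  where
  dec : ∀ {n} → Decidable₂ (WheelAdj {n})
  dec zero    zero    = no λ ()
  dec zero    (suc _) = yes tt
  dec (suc _) zero    = yes tt
  dec (suc i) (suc j) = cycleAdj? i j

  symm : ∀ {n} (u v : Fin n) → WheelAdj u v → WheelAdj v u
  symm zero    (suc _) _ = tt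
  symm (suc _) zero    _ = tt
  symm (suc i) (suc j) (i≢j , e) = i≢j ∘ sym , swap e

  irr : ∀ {n} (u : Fin n) → ¬ WheelAdj u u
  irr (suc i) (i≢i , _) = i≢i refl

RimEdge : ∀ {n} → Fin n → Fin n → Set
RimEdge (suc i) (suc j) = CycleAdj i j
RimEdge _       _       = ⊥

wheel-e : ∀ n → (a b : Fin n) → SimpleGraph n
wheel-e n a b = deleteEdge (wheel n) a b

wheel-e-connected : ∀ {n} (a b : Fin n) → RimEdge a b → Connected (wheel-e n a b)
wheel-e-connected {n} (suc a) (suc b) _ = conn
  where
  open SimpleGraph (wheel-e n (suc a) (suc b)) using (Adj)

  spoke : ∀ i → Adj zero (suc i)
  spoke i = tt , λ { (inj₁ ()) ; (inj₂ ()) }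

  spoke′ : ∀ i → Adj (suc i) zero
  spoke′ i = tt , λ { (inj₁ ()) ; (inj₂ ()) }

  conn : Connected (wheel-e n (suc a) (suc b))
  conn zero    zero    = 0 , nil , [] ∷ []
  conn zero    (suc j) = 1 , cons (spoke j) nil , (0≢1+n ∷ []) ∷ [] ∷ []
  conn (suc i) zero    = 1 , cons (spoke′ i) nil , ((λ ()) ∷ []) ∷ [] ∷ []
  conn (suc i) (suc j) with i ≟ j
  ... | yes refl = 0 , nil , [] ∷ []
  ... | no i≢j   = 2 , cons (spoke′ i) (cons (spoke j) nil) ,
    ((λ ()) ∷ (i≢j ∘ suc-injective) ∷ []) ∷ (0≢1+n ∷ []) ∷ [] ∷ []

T : ∀ m → Matrix m
T m i j = if ⌊ ∣ toℕ i - toℕ j ∣ ℕ.≤? 1 ⌋ then - (+ 2) else 0ℤ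

B : ∀ n → Matrix n
B _         zero    zero    = 0ℤ
B _         zero    (suc _) = 1ℤ
B _         (suc _) zero    = 1ℤ
B (suc m)   (suc i) (suc j) = T m i j

{-# OPTIONS --safe #-}

-- In the wheel minus a rim edge every spoke has distance 1, and every rim vertex
-- has eccentricity 2 because n ≥ 5 leaves it a non-neighbour. Hence E has ones
-- along the border and, on the rim, 2 exactly for the pairs that are neither equal nor
-- adjacent. Subtracting twice the hub row from every rim row turns this into 0
-- and -2, and rotating the rim so that the deleted edge joins its last vertex to its
-- first makes it the tridiagonal matrix T, which gives B.
--
-- Let u m = det T_m, b m = det B_{m+1}, and let f m be the determinant of T_{m+1}
-- with its first row replaced by ones. Laplace expansion gives
--   u (m+2) = -2 u (m+1) - 4 u m,   f (m+1) = u (m+1) + 2 f m,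
--   b (m+2) = -2 b (m+1) - 4 b m - f (m+1) - 2 f m,
-- and three steps of this recurrence multiply u and f by 8.

module Submission where

open import Defs
import Algebra.Properties.CommutativeMonoid.Sum
import Algebra.Properties.Monoid.Sum
import Algebra.Properties.Semiring.Sum
open import Data.Bool.Base using (if_then_else_)
open import Data.Empty using (⊥-elim)
open import Data.Fin.Base using (Fin; zero; suc; toℕ; punchIn; fromℕ; inject₁)
open import Data.Fin.Patterns using (0F; 1F; 2F)
open import Data.Fin.Properties
  using (_≟_; toℕ-injective; toℕ-fromℕ; toℕ-inject₁; toℕ<n; fromℕ≢inject₁; inject₁-injective; suc-injective)
open import Data.Integer.Base using (ℤ; +_; +[1+_]; -[1+_]; -_; _*_; 0ℤ; 1ℤ; -1ℤ)
  renaming (_+_ to _+ℤ_; _-_ to _-ℤ_; _^_ to _^ℤ_)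
import Data.Integer.Properties as ℤ
open import Data.Integer.Tactic.RingSolver using (solve-∀)
import Data.List.Extrema as Extrema
open import Data.List.Membership.Propositional.Properties using (∈-tabulate⁺)
open import Data.List.Relation.Unary.All using ([]; _∷_)
open import Data.List.Relation.Unary.All.Properties using (tabulate⁺)
open import Data.List.Relation.Unary.AllPairs using ([]; _∷_)
open import Data.Nat.Base using (ℕ; zero; suc; _≤_; _<_; _∸_; _+_; _^_; _/_; _%_; ∣_-_∣; _⊓_; s≤s; z≤n)
import Data.Nat.Base as ℕ
open import Data.Nat.DivMod using (m≡m%n+[m/n]*n; m*n/n≡m)
import Data.Nat.Properties as ℕ
open import Data.Product.Base using (∃; _×_; _,_; proj₁; proj₂)
open import Data.Sum.Base using (_⊎_; inj₁; inj₂; swap; [_,_]′)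
import Data.Sum.Base as Sum
open import Data.Unit.Base using (tt)
open import Data.Vec.Functional using () renaming (_∷_ to infixr 5 _◂_)
open import Function.Base using (_∘_; id; flip)
open import Relation.Binary.PropositionalEquality
  using (_≡_; _≢_; refl; sym; trans; cong; cong₂; subst; module ≡-Reasoning)
open import Relation.Nullary.Decidable using (Dec; yes; no; _⊎-dec_; ⌊_⌋; isYes≗does; dec-true; dec-false)
open import Relation.Nullary.Negation.Core using (¬_)
open ≡-Reasoning

open Algebra.Properties.Monoid.Sum ℤ.+-0-monoid using (sum; sum-cong-≗; sum-replicate-zero)
open Algebra.Properties.CommutativeMonoid.Sum ℤ.+-0-commutativeMonoid using (∑-distrib-+; ∑-comm)
open Algebra.Properties.Semiring.Sum ℤ.+-*-semiring using (*-distribˡ-sum)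

-- Determinants

sgn : ∀ {n} → Fin n → ℤ
sgn i = -1ℤ ^ℤ toℕ i

minor : ∀ {n} → Matrix (suc n) → Fin (suc n) → Matrix n
minor A j i k = A (suc i) (punchIn j k)

sum-zero : ∀ {n} {f : Fin n → ℤ} → (∀ i → f i ≡ 0ℤ) → sum f ≡ 0ℤ
sum-zero {n} f≗0 = trans (sum-cong-≗ f≗0) (sum-replicate-zero n)

det-cong : ∀ {n} {A A′ : Matrix n} → (∀ i j → A i j ≡ A′ i j) → det A ≡ det A′
det-cong {zero}  A≗A′ = refl
det-cong {suc n} A≗A′ = sum-cong-≗ λ j →
  cong₂ _*_ (cong (sgn j *_) (A≗A′ zero j)) (det-cong λ i k → A≗A′ (suc i) (punchIn j k))

-- Lets a factor gained by permuting rows pass through the Laplace expansion when the first row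
-- stays in place.
det-scaleMinors : ∀ {n} s {A A′ : Matrix (suc n)} → (∀ j → A zero j ≡ A′ zero j) →
                  (∀ j → det (minor A j) ≡ s * det (minor A′ j)) → det A ≡ s * det A′
det-scaleMinors s {A} {A′} row minors = trans (sum-cong-≗ λ j →
    trans (cong₂ (λ x y → sgn j * x * y) (row j) (minors j))
          (pull (sgn j) (A′ zero j) s (det (minor A′ j))))
  (sym (*-distribˡ-sum s λ j → sgn j * A′ zero j * det (minor A′ j)))
  where
  pull : ∀ a b s d → a * b * (s * d) ≡ s * (a * b * d)
  pull = solve-∀

-- The minors along the first row do not see that row, so each Laplace term is linear in it.
det-linearRow : ∀ {n} c (x y : Fin (suc n) → ℤ) (R : Fin n → Fin (suc n) → ℤ) →
                det ((λ j → x j +ℤ c * y j) ◂ R) ≡ det (x ◂ R) +ℤ c * det (y ◂ R)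
det-linearRow c x y R = begin
  sum (λ j → sgn j * (x j +ℤ c * y j) * d j)
    ≡⟨ sum-cong-≗ (λ j → distr (sgn j) (x j) c (y j) (d j)) ⟩
  sum (λ j → sgn j * x j * d j +ℤ c * (sgn j * y j * d j))
    ≡⟨ ∑-distrib-+ (λ j → sgn j * x j * d j) (λ j → c * (sgn j * y j * d j)) ⟩
  det (x ◂ R) +ℤ sum (λ j → c * (sgn j * y j * d j))
    ≡⟨ cong (det (x ◂ R) +ℤ_) (*-distribˡ-sum c (λ j → sgn j * y j * d j)) ⟨
  det (x ◂ R) +ℤ c * det (y ◂ R) ∎
  where
  d : ∀ j → ℤ
  d j = det (λ i k → R i (punchIn j k))
  distr : ∀ s x c y d → s * (x +ℤ c * y) * d ≡ s * x * d +ℤ c * (s * y * d)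
  distr = solve-∀

-- By induction: the corner term is common to both expansions. Expanding every other minor along its
-- first column gives a double sum that is symmetric in signs and entries, so exchanging the
-- summations yields the column expansion.
det-expandColumn : ∀ {n} (A : Matrix (suc n)) →
  det A ≡ sum λ i → sgn i * A i zero * det (λ r k → A (punchIn i r) (suc k))
det-expandColumn {zero}  A = refl
det-expandColumn {suc n} A = cong (sgn {suc (suc n)} zero * A zero zero * det (minor A zero) +ℤ_) (begin
  sum (λ j → sgn (suc j) * A zero (suc j) * det (minor A (suc j)))
    ≡⟨ sum-cong-≗ (λ j → cong (sgn (suc j) * A zero (suc j) *_) (det-expandColumn (minor A (suc j)))) ⟩
  sum (λ j → sgn (suc j) * A zero (suc j) * sum λ i → sgn i * A (suc i) zero * d i j)
    ≡⟨ sum-cong-≗ (λ j → *-distribˡ-sum (sgn (suc j) * A zero (suc j)) λ i → sgn i * A (suc i) zero * d i j) ⟩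
  sum (λ j → sum λ i → sgn (suc j) * A zero (suc j) * (sgn i * A (suc i) zero * d i j))
    ≡⟨ ∑-comm (λ j i → sgn (suc j) * A zero (suc j) * (sgn i * A (suc i) zero * d i j)) ⟩
  sum (λ i → sum λ j → sgn (suc j) * A zero (suc j) * (sgn i * A (suc i) zero * d i j))
    ≡⟨ sum-cong-≗ (λ i → sum-cong-≗ λ j →
         exchange -1ℤ (sgn j) (A zero (suc j)) (sgn i) (A (suc i) zero) (d i j)) ⟩
  sum (λ i → sum λ j → sgn (suc i) * A (suc i) zero * (sgn j * A zero (suc j) * d i j))
    ≡⟨ sum-cong-≗ (λ i → *-distribˡ-sum (sgn (suc i) * A (suc i) zero) λ j → sgn j * A zero (suc j) * d i j) ⟨
  sum (λ i → sgn (suc i) * A (suc i) zero * sum λ j → sgn j * A zero (suc j) * d i j) ∎)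
  where
  d : Fin (suc n) → Fin (suc n) → ℤ
  d i j = det (λ r k → A (suc (punchIn i r)) (suc (punchIn j k)))
  exchange : ∀ m s a t b d → m * s * a * (t * b * d) ≡ m * t * b * (s * a * d)
  exchange = solve-∀

det-transpose : ∀ {n} (A : Matrix n) → det (flip A) ≡ det A
det-transpose {zero}  A = refl
det-transpose {suc n} A = trans
  (sum-cong-≗ λ j → cong (sgn j * A j zero *_) (det-transpose λ r k → A (punchIn j r) (suc k)))
  (sym (det-expandColumn A))

swap₀₁ : ∀ {n} → Fin (suc (suc n)) → Fin (suc (suc n))
swap₀₁ zero          = suc zero
swap₀₁ (suc zero)    = zero
swap₀₁ (suc (suc i)) = suc (suc i)

-- The swap exchanges the minors at columns 0 and 1, whose signs are opposite. Every later minor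
-- still contains both swapped columns as its first two, so induction negates it.
det-swapColumns : ∀ {n} (A : Matrix (suc (suc n))) → det (λ i j → A i (swap₀₁ j)) ≡ - det A
det-swapColumns {n} A = begin
  det A′
    ≡⟨ cong₂ (λ x y → 1ℤ * a₁ * x +ℤ (-1ℤ * 1ℤ * a₀ * y +ℤ sum t′))
         (det-cong λ i k → cong (A (suc i)) (at0 k)) (det-cong λ i k → cong (A (suc i)) (at1 k)) ⟩
  1ℤ * a₁ * d₁ +ℤ (-1ℤ * 1ℤ * a₀ * d₀ +ℤ sum t′)
    ≡⟨ cong (λ x → 1ℤ * a₁ * d₁ +ℤ (-1ℤ * 1ℤ * a₀ * d₀ +ℤ x)) (rest A) ⟩
  1ℤ * a₁ * d₁ +ℤ (-1ℤ * 1ℤ * a₀ * d₀ +ℤ -1ℤ * sum t)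
    ≡⟨ neg a₀ a₁ d₀ d₁ (sum t) ⟩
  - det A ∎
  where
  A′ : Matrix (suc (suc n))
  A′ i j = A i (swap₀₁ j)
  t t′ : Fin n → ℤ
  t  j = sgn (suc (suc j)) * A  zero (suc (suc j)) * det (minor A  (suc (suc j)))
  t′ j = sgn (suc (suc j)) * A′ zero (suc (suc j)) * det (minor A′ (suc (suc j)))
  a₀ a₁ d₀ d₁ : ℤ
  a₀ = A zero zero
  a₁ = A zero (suc zero)
  d₀ = det (minor A zero)
  d₁ = det (minor A (suc zero))
  at0 : ∀ k → swap₀₁ {n} (suc k) ≡ punchIn (suc zero) k
  at0 zero    = refl
  at0 (suc k) = refl
  at1 : ∀ k → swap₀₁ {n} (punchIn (suc zero) k) ≡ suc k
  at1 zero    = refl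
  at1 (suc k) = refl
  neg : ∀ a₀ a₁ d₀ d₁ t → 1ℤ * a₁ * d₁ +ℤ (-1ℤ * 1ℤ * a₀ * d₀ +ℤ -1ℤ * t)
                        ≡ - (1ℤ * a₀ * d₀ +ℤ (-1ℤ * 1ℤ * a₁ * d₁ +ℤ t))
  neg = solve-∀
  -- Stated for its own size so that it can split on it: once a third column exists, the minors are
  -- large enough for the induction.
  rest : ∀ {n} (A : Matrix (suc (suc n))) →
    sum (λ (j : Fin n) → sgn (suc (suc j)) * A zero (suc (suc j)) *
          det (λ i k → A (suc i) (swap₀₁ (punchIn (suc (suc j)) k))))
    ≡ -1ℤ * sum (λ (j : Fin n) → sgn (suc (suc j)) * A zero (suc (suc j)) * det (minor A (suc (suc j))))
  rest {zero}  A = refl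
  rest {suc n} A = trans
    (sum-cong-≗ λ j → trans
      (cong (sgn (suc (suc j)) * A zero (suc (suc j)) *_)
        (trans (det-cong λ i k → cong (A (suc i)) (commute j k))
               (det-swapColumns (minor A (suc (suc j))))))
      (out (sgn (suc (suc j))) (A zero (suc (suc j))) (det (minor A (suc (suc j))))))
    (sym (*-distribˡ-sum -1ℤ λ j → sgn (suc (suc j)) * A zero (suc (suc j)) * det (minor A (suc (suc j)))))
    where
    commute : ∀ j k → swap₀₁ (punchIn (suc (suc j)) k) ≡ punchIn (suc (suc j)) (swap₀₁ k)
    commute j zero          = refl
    commute j (suc zero)    = refl
    commute j (suc (suc k)) = refl
    out : ∀ s a d → s * a * - d ≡ -1ℤ * (s * a * d)
    out = solve-∀

det-swapRows : ∀ {n} (A : Matrix (suc (suc n))) → det (A ∘ swap₀₁) ≡ - det A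
det-swapRows A = begin
  det (A ∘ swap₀₁)                ≡⟨ det-transpose (A ∘ swap₀₁) ⟨
  det (λ i j → flip A i (swap₀₁ j)) ≡⟨ det-swapColumns (flip A) ⟩
  - det (flip A)                  ≡⟨ cong -_ (det-transpose A) ⟩
  - det A                         ∎

i≡-i⇒i≡0 : ∀ {i} → i ≡ - i → i ≡ 0ℤ
i≡-i⇒i≡0 {+ zero}   _ = refl
i≡-i⇒i≡0 {+[1+ _ ]} ()
i≡-i⇒i≡0 { -[1+ _ ]} ()

addFirstRow : ∀ {n} → (Fin n → ℤ) → Matrix (suc n) → Matrix (suc n)
addFirstRow c A zero    j = A zero j
addFirstRow c A (suc i) j = A (suc i) j +ℤ c i * A zero j

-- Swapping the first two rows makes the modified row linear in the Laplace
-- expansion, and each minor then has the old first row on top.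
det-addFirstRow : ∀ {n} (c : Fin n → ℤ) (A : Matrix (suc n)) → det (addFirstRow c A) ≡ det A
det-addFirstRow {zero}  c A = det-cong {A = addFirstRow c A} {A} λ { zero _ → refl }
det-addFirstRow {suc n} c A = begin
  det A₊                                    ≡⟨ ℤ.neg-involutive _ ⟨
  - - det A₊                                ≡⟨ cong -_ (det-swapRows A₊) ⟨
  - det (A₊ ∘ swap₀₁)                       ≡⟨ cong -_ (det-cong rows) ⟩
  - det ((λ j → A (suc zero) j +ℤ c zero * A zero j) ◂ R)
    ≡⟨ cong -_ (det-linearRow (c zero) (A (suc zero)) (A zero) R) ⟩
  - (det (A (suc zero) ◂ R) +ℤ c zero * det (A zero ◂ R))
    ≡⟨ cong₂ (λ x y → - (x +ℤ c zero * y)) first second ⟩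
  - (- det A +ℤ c zero * 0ℤ)                ≡⟨ tidy (det A) (c zero) ⟩
  det A                                     ∎
  where
  A₊ : Matrix (suc (suc n))
  A₊ = addFirstRow c A
  R S : Fin (suc n) → Fin (suc (suc n)) → ℤ
  R = A zero ◂ λ i → A₊ (suc (suc i))
  S = A zero ◂ λ i → A (suc (suc i))
  rows : ∀ i j → A₊ (swap₀₁ i) j ≡ ((λ j → A (suc zero) j +ℤ c zero * A zero j) ◂ R) i j
  rows zero          j = refl
  rows (suc zero)    j = refl
  rows (suc (suc i)) j = refl
  minors : ∀ j i k → R i (punchIn j k) ≡ addFirstRow (c ∘ suc) (λ i k → S i (punchIn j k)) i k
  minors j zero    k = refl
  minors j (suc i) k = refl
  swapped : ∀ i j → (A (suc zero) ◂ S) i j ≡ A (swap₀₁ i) j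
  swapped zero          j = refl
  swapped (suc zero)    j = refl
  swapped (suc (suc i)) j = refl
  equal : ∀ i j → (A zero ◂ R) i j ≡ (A zero ◂ R) (swap₀₁ i) j
  equal zero          j = refl
  equal (suc zero)    j = refl
  equal (suc (suc i)) j = refl
  first : det (A (suc zero) ◂ R) ≡ - det A
  first = begin
    det (A (suc zero) ◂ R)
      ≡⟨ sum-cong-≗ (λ j → cong (sgn j * A (suc zero) j *_)
           (trans (det-cong (minors j)) (det-addFirstRow (c ∘ suc) (λ i k → S i (punchIn j k))))) ⟩
    det (A (suc zero) ◂ S)   ≡⟨ det-cong swapped ⟩
    det (A ∘ swap₀₁)         ≡⟨ det-swapRows A ⟩
    - det A                  ∎
  -- The two top rows are both `A zero`, so the swap negates the determinant without changing the
  -- matrix.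
  second : det (A zero ◂ R) ≡ 0ℤ
  second = i≡-i⇒i≡0 (trans (det-cong equal) (det-swapRows (A zero ◂ R)))
  tidy : ∀ d c → - (- d +ℤ c * 0ℤ) ≡ d
  tidy = solve-∀

-- Conjugation by permutations, in particular by the cyclic shift i ↦ i - 1.

rotate : ∀ {k} → Fin (suc k) → Fin (suc k)
rotate {k} zero    = fromℕ k
rotate     (suc i) = inject₁ i

lift₀ : ∀ {m n} → (Fin m → Fin n) → Fin (suc m) → Fin (suc n)
lift₀ σ zero    = zero
lift₀ σ (suc i) = suc (σ i)

det-lift₀ : ∀ {n} s (σ : Fin n → Fin n) → (∀ A → det (A ∘ σ) ≡ s * det A) →
            ∀ A → det (A ∘ lift₀ σ) ≡ s * det A
det-lift₀ s σ h A = det-scaleMinors s {A ∘ lift₀ σ} {A} (λ _ → refl) λ j → h (minor A j)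

-- rotate agrees with swapping the first two rows after rotating all rows but the first.
det-rotateRows : ∀ {k} (A : Matrix (suc k)) → det (A ∘ rotate) ≡ -1ℤ ^ℤ k * det A
det-rotateRows {zero}  A = trans (det-cong {A = A ∘ rotate} {A} λ { zero _ → refl }) (sym (ℤ.*-identityˡ (det A)))
det-rotateRows {suc k} A = begin
  det (A ∘ rotate)                        ≡⟨ det-cong rows ⟩
  det ((A ∘ lift₀ rotate) ∘ swap₀₁)       ≡⟨ det-swapRows (A ∘ lift₀ rotate) ⟩
  - det (A ∘ lift₀ rotate)                ≡⟨ cong -_ (det-lift₀ (-1ℤ ^ℤ k) rotate det-rotateRows A) ⟩
  - (-1ℤ ^ℤ k * det A)                    ≡⟨ neg (-1ℤ ^ℤ k) (det A) ⟩
  -1ℤ ^ℤ suc k * det A                    ∎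
  where
  rows : ∀ i j → A (rotate i) j ≡ A (lift₀ rotate (swap₀₁ i)) j
  rows zero          j = refl
  rows (suc zero)    j = refl
  rows (suc (suc i)) j = refl
  neg : ∀ s d → - (s * d) ≡ -1ℤ * s * d
  neg = solve-∀

-1^k-square : ∀ k → -1ℤ ^ℤ k * -1ℤ ^ℤ k ≡ 1ℤ
-1^k-square zero    = refl
-1^k-square (suc k) = trans (sq (-1ℤ ^ℤ k)) (-1^k-square k)
  where
  sq : ∀ s → -1ℤ * s * (-1ℤ * s) ≡ s * s
  sq = solve-∀

-- The factor `s` appears once for the rows and, after transposing, once for the columns, and the
-- two cancel.
det-conjugate : ∀ {n} s (σ : Fin n → Fin n) → s * s ≡ 1ℤ → (∀ A → det (A ∘ σ) ≡ s * det A) →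
                ∀ A → det (λ i j → A (σ i) (σ j)) ≡ det A
det-conjugate s σ ss h A = begin
  det (λ i j → A (σ i) (σ j))   ≡⟨ h (λ i j → A i (σ j)) ⟩
  s * det (λ i j → A i (σ j))   ≡⟨ cong (s *_) (det-transpose (λ i j → A i (σ j))) ⟨
  s * det (flip A ∘ σ)          ≡⟨ cong (s *_) (h (flip A)) ⟩
  s * (s * det (flip A))        ≡⟨ ℤ.*-assoc s s _ ⟨
  s * s * det (flip A)          ≡⟨ cong₂ _*_ ss (det-transpose A) ⟩
  1ℤ * det A                    ≡⟨ ℤ.*-identityˡ _ ⟩
  det A                         ∎

det-conjugateRotation : ∀ {k} (A : Matrix (suc (suc k))) →
  det (λ i j → A (lift₀ rotate i) (lift₀ rotate j)) ≡ det A
det-conjugateRotation {k} = det-conjugate (-1ℤ ^ℤ k) (lift₀ rotate) (-1^k-square k)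
  (det-lift₀ (-1ℤ ^ℤ k) rotate det-rotateRows)

-- Laplace expansions along nearly empty rows and columns.

pattern 2+F i = suc (suc i)
pattern 3+F i = suc (suc (suc i))

zeroTerm : ∀ s {a} d → a ≡ 0ℤ → s * a * d ≡ 0ℤ
zeroTerm s d refl = trans (cong (_* d) (ℤ.*-zeroʳ s)) (ℤ.*-zeroˡ d)

det-row₁ : ∀ {n} (A : Matrix (suc n)) → (∀ j → A 0F (suc j) ≡ 0ℤ) →
           det A ≡ A 0F 0F * det (minor A 0F)
det-row₁ {n} A z = trans
  (cong (1ℤ * A 0F 0F * det (minor A 0F) +ℤ_)
    (sum-zero λ j → zeroTerm (sgn (suc j)) (det (minor A (suc j))) (z j)))
  (tidy (A 0F 0F) (det (minor A 0F)))
  where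
  tidy : ∀ a d → 1ℤ * a * d +ℤ 0ℤ ≡ a * d
  tidy = solve-∀

det-row₃ : ∀ {n} (A : Matrix (3 + n)) → (∀ j → A 0F (3+F j) ≡ 0ℤ) →
           det A ≡ A 0F 0F * det (minor A 0F) -ℤ A 0F 1F * det (minor A 1F) +ℤ A 0F 2F * det (minor A 2F)
det-row₃ {n} A z = trans
  (cong (λ x → 1ℤ * A 0F 0F * det (minor A 0F) +ℤ (-1ℤ * 1ℤ * A 0F 1F * det (minor A 1F)
                 +ℤ (-1ℤ * (-1ℤ * 1ℤ) * A 0F 2F * det (minor A 2F) +ℤ x)))
    (sum-zero λ j → zeroTerm (sgn (3+F j)) (det (minor A (3+F j))) (z j)))
  (tidy (A 0F 0F) (det (minor A 0F)) (A 0F 1F) (det (minor A 1F)) (A 0F 2F) (det (minor A 2F)))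
  where
  tidy : ∀ a d b e c f → 1ℤ * a * d +ℤ (-1ℤ * 1ℤ * b * e +ℤ (-1ℤ * (-1ℤ * 1ℤ) * c * f +ℤ 0ℤ))
                         ≡ a * d -ℤ b * e +ℤ c * f
  tidy = solve-∀

det-column₂ : ∀ {n} (A : Matrix (2 + n)) → (∀ i → A (2+F i) 0F ≡ 0ℤ) →
  det A ≡ A 0F 0F * det (λ r k → A (suc r) (suc k)) -ℤ A 1F 0F * det (λ r k → A (punchIn 1F r) (suc k))
det-column₂ {n} A z = trans (det-expandColumn A) (trans
  (cong (λ x → 1ℤ * A 0F 0F * d₀ +ℤ (-1ℤ * 1ℤ * A 1F 0F * d₁ +ℤ x))
    (sum-zero λ i → zeroTerm (sgn (2+F i)) (det (λ r k → A (punchIn (2+F i) r) (suc k))) (z i)))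
  (tidy (A 0F 0F) d₀ (A 1F 0F) d₁))
  where
  d₀ d₁ : ℤ
  d₀ = det (λ r k → A (suc r) (suc k))
  d₁ = det (λ r k → A (punchIn 1F r) (suc k))
  tidy : ∀ a d b e → 1ℤ * a * d +ℤ (-1ℤ * 1ℤ * b * e +ℤ 0ℤ) ≡ a * d -ℤ b * e
  tidy = solve-∀

-- The recurrences for det T and det B

T-sym : ∀ m i j → T m i j ≡ T m j i
T-sym m i j = cong (λ d → if ⌊ d ℕ.≤? 1 ⌋ then - (+ 2) else 0ℤ) (ℕ.∣-∣-comm (toℕ i) (toℕ j))

topOnes : ∀ k → Matrix (suc k)
topOnes k = (λ _ → 1ℤ) ◂ λ i → T (suc k) (suc i)

-- The first column has entries only in rows 0 and 1. Without row 1 the top row that is left has a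
-- single entry, so one more expansion reaches `T m`.
det-T-rec : ∀ m → det (T (2 + m)) ≡ - (+ 2) * det (T (suc m)) -ℤ + 4 * det (T m)
det-T-rec m = begin
  det (T (2 + m))
    ≡⟨ det-column₂ (T (2 + m)) (λ _ → refl) ⟩
  - (+ 2) * det (T (suc m)) -ℤ - (+ 2) * det N
    ≡⟨ cong (λ x → - (+ 2) * det (T (suc m)) -ℤ - (+ 2) * x) (det-row₁ N (λ _ → refl)) ⟩
  - (+ 2) * det (T (suc m)) -ℤ - (+ 2) * (- (+ 2) * det (T m))
    ≡⟨ tidy (det (T (suc m))) (det (T m)) ⟩
  - (+ 2) * det (T (suc m)) -ℤ + 4 * det (T m) ∎
  where
  N : Matrix (suc m)
  N r k = T (2 + m) (punchIn 1F r) (suc k)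
  tidy : ∀ x y → - (+ 2) * x -ℤ - (+ 2) * (- (+ 2) * y) ≡ - (+ 2) * x -ℤ + 4 * y
  tidy = solve-∀

-- Deleting the row of ones leaves a tridiagonal matrix; deleting row 1 keeps the ones on top of a
-- shorter one.
det-topOnes-rec : ∀ k → det (topOnes (suc k)) ≡ det (T (suc k)) +ℤ + 2 * det (topOnes k)
det-topOnes-rec k = begin
  det (topOnes (suc k))
    ≡⟨ det-column₂ (topOnes (suc k)) (λ _ → refl) ⟩
  1ℤ * det (T (suc k)) -ℤ - (+ 2) * det N
    ≡⟨ cong (λ x → 1ℤ * det (T (suc k)) -ℤ - (+ 2) * x)
         (det-cong {A = N} {topOnes k} λ { zero _ → refl ; (suc _) _ → refl }) ⟩
  1ℤ * det (T (suc k)) -ℤ - (+ 2) * det (topOnes k)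
    ≡⟨ tidy (det (T (suc k))) (det (topOnes k)) ⟩
  det (T (suc k)) +ℤ + 2 * det (topOnes k) ∎
  where
  N : Matrix (suc k)
  N r c = topOnes (suc k) (punchIn 1F r) (suc c)
  tidy : ∀ x y → 1ℤ * x -ℤ - (+ 2) * y ≡ x +ℤ + 2 * y
  tidy = solve-∀

-- The first rim vertex is moved in front of the hub, so that only three entries
-- of the first row are nonzero.
det-B-rec : ∀ m → det (B (3 + m)) ≡
  - (+ 2) * det (B (2 + m)) -ℤ + 4 * det (B (suc m))
  -ℤ det (topOnes (suc m)) -ℤ + 2 * det (topOnes m)
det-B-rec m = begin
  det (B (3 + m))
    ≡⟨ det-conjugate -1ℤ swap₀₁ refl (λ A → trans (det-swapRows A) (sym (ℤ.-1*i≡-i (det A)))) (B (3 + m)) ⟨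
  det B′
    ≡⟨ det-row₃ B′ (λ _ → refl) ⟩
  - (+ 2) * det (minor B′ 0F) -ℤ 1ℤ * det (minor B′ 1F) +ℤ - (+ 2) * det M
    ≡⟨ cong₂ (λ x y → - (+ 2) * x -ℤ 1ℤ * y +ℤ - (+ 2) * det M)
         (det-cong {A = minor B′ 0F} {B (2 + m)} minor₀)
         (det-cong {A = minor B′ 1F} {topOnes (suc m)} minor₁) ⟩
  - (+ 2) * det (B (2 + m)) -ℤ 1ℤ * det (topOnes (suc m)) +ℤ - (+ 2) * det M
    ≡⟨ cong (λ x → - (+ 2) * det (B (2 + m)) -ℤ 1ℤ * det (topOnes (suc m)) +ℤ - (+ 2) * x) (begin
         det M
           -- The first column of `M` belongs to the first rim vertex and has two nonzero entries.
           -- Without the hub row, the hub column becomes a column of ones, giving a transposed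
           -- `topOnes m`; without the row of the second rim vertex, a smaller `B` remains.
           ≡⟨ det-column₂ M (λ _ → refl) ⟩
         1ℤ * det (λ r k → M (suc r) (suc k)) -ℤ - (+ 2) * det (λ r k → M (punchIn 1F r) (suc k))
           ≡⟨ cong₂ (λ x y → 1ℤ * x -ℤ - (+ 2) * y)
                (trans (det-cong {A = λ r k → M (suc r) (suc k)} {flip (topOnes m)} minor₂₀)
                       (det-transpose (topOnes m)))
                (det-cong {A = λ r k → M (punchIn 1F r) (suc k)} {B (suc m)} minor₂₁) ⟩
         1ℤ * det (topOnes m) -ℤ - (+ 2) * det (B (suc m)) ∎) ⟩
  - (+ 2) * det (B (2 + m)) -ℤ 1ℤ * det (topOnes (suc m))
    +ℤ - (+ 2) * (1ℤ * det (topOnes m) -ℤ - (+ 2) * det (B (suc m)))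
    ≡⟨ tidy (det (B (2 + m))) (det (B (suc m))) (det (topOnes (suc m))) (det (topOnes m)) ⟩
  _ ∎
  where
  B′ : Matrix (3 + m)
  B′ i j = B (3 + m) (swap₀₁ i) (swap₀₁ j)
  M : Matrix (2 + m)
  M = minor B′ 2F
  minor₀ : ∀ i k → minor B′ 0F i k ≡ B (2 + m) i k
  minor₀ zero    zero    = refl
  minor₀ zero    (suc _) = refl
  minor₀ (suc _) zero    = refl
  minor₀ (suc _) (suc _) = refl
  minor₁ : ∀ i k → minor B′ 1F i k ≡ topOnes (suc m) i k
  minor₁ zero    zero    = refl
  minor₁ zero    (suc _) = refl
  minor₁ (suc _) zero    = refl
  minor₁ (suc _) (suc _) = refl
  minor₂₀ : ∀ r k → M (suc r) (suc k) ≡ topOnes m k r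
  minor₂₀ r zero    = refl
  minor₂₀ r (suc k) = T-sym (suc m) r (suc k)
  minor₂₁ : ∀ r k → M (punchIn 1F r) (suc k) ≡ B (suc m) r k
  minor₂₁ zero    zero    = refl
  minor₂₁ zero    (suc _) = refl
  minor₂₁ (suc _) zero    = refl
  minor₂₁ (suc _) (suc _) = refl
  tidy : ∀ x y f g → - (+ 2) * x -ℤ 1ℤ * f +ℤ - (+ 2) * (1ℤ * g -ℤ - (+ 2) * y)
                   ≡ - (+ 2) * x -ℤ + 4 * y -ℤ f -ℤ + 2 * g
  tidy = solve-∀

-- Closed forms

2^[q*3] : ℕ → ℤ
2^[q*3] q = + (2 ^ (q ℕ.* 3))

2^[q*3]-suc : ∀ q → 2^[q*3] (suc q) ≡ + 8 * 2^[q*3] q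
2^[q*3]-suc q = trans (cong +_ (ℕ.^-distribˡ-+-* 2 3 (q ℕ.* 3))) (ℤ.pos-* 8 (2 ^ (q ℕ.* 3)))

-- The sequences are parameters, so only their recurrences are visible and no determinant unfolds.
module ClosedForm (u f b : ℕ → ℤ)
  (u-rec : ∀ m → u (2 + m) ≡ - (+ 2) * u (suc m) -ℤ + 4 * u m)
  (f-rec : ∀ m → f (suc m) ≡ u (suc m) +ℤ + 2 * f m)
  (b-rec : ∀ m → b (2 + m) ≡ - (+ 2) * b (suc m) -ℤ + 4 * b m -ℤ f (suc m) -ℤ + 2 * f m)
  (u₀ : u 0 ≡ 1ℤ) (u₁ : u 1 ≡ - (+ 2)) (f₀ : f 0 ≡ 1ℤ) (b₀ : b 0 ≡ 0ℤ) (b₁ : b 1 ≡ -1ℤ)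
  where

  u-step : ∀ {m x y} → u m ≡ x → u (suc m) ≡ y → u (2 + m) ≡ - (+ 2) * y -ℤ + 4 * x
  u-step {m} refl refl = u-rec m

  f-step : ∀ {m x y} → u (suc m) ≡ x → f m ≡ y → f (suc m) ≡ x +ℤ + 2 * y
  f-step {m} refl refl = f-rec m

  b-step : ∀ {m x y f₁ f₂} → b (suc m) ≡ x → b m ≡ y → f (suc m) ≡ f₁ → f m ≡ f₂ →
           b (2 + m) ≡ - (+ 2) * x -ℤ + 4 * y -ℤ f₁ -ℤ + 2 * f₂
  b-step {m} refl refl refl refl = b-rec m

  -- The characteristic polynomial x^2 + 2x + 4 divides x^3 - 8, hence the factor 8 over three
  -- steps.
  u-closed : ∀ q → u (q ℕ.* 3) ≡ 2^[q*3] q × u (1 + q ℕ.* 3) ≡ - (+ 2) * 2^[q*3] q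
                 × u (2 + q ℕ.* 3) ≡ 0ℤ
  u-closed zero    = u₀ , u₁ , trans (u-rec 0) (cong₂ (λ x y → - (+ 2) * y -ℤ + 4 * x) u₀ u₁)
  u-closed (suc q) =
    let _ , v₁ , v₂ = u-closed q
        w₀ = trans (u-step v₁ v₂) (trans (t₀ (2^[q*3] q)) (sym (2^[q*3]-suc q)))
        w₁ = trans (u-step v₂ w₀) (t₁ (2^[q*3] (suc q)))
        w₂ = trans (u-step w₀ w₁) (t₂ (2^[q*3] (suc q)))
    in w₀ , w₁ , w₂
    where
    t₀ : ∀ p → - (+ 2) * 0ℤ -ℤ + 4 * (- (+ 2) * p) ≡ + 8 * p
    t₀ = solve-∀
    t₁ : ∀ p → - (+ 2) * p -ℤ + 4 * 0ℤ ≡ - (+ 2) * p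
    t₁ = solve-∀
    t₂ : ∀ p → - (+ 2) * (- (+ 2) * p) -ℤ + 4 * p ≡ 0ℤ
    t₂ = solve-∀

  -- At 3q + 1 the term from `u` cancels twice the previous value, and at 3q + 2 both terms vanish,
  -- so `f` restarts from `u` at every multiple of three.
  f-closed : ∀ q → f (q ℕ.* 3) ≡ 2^[q*3] q × f (1 + q ℕ.* 3) ≡ 0ℤ × f (2 + q ℕ.* 3) ≡ 0ℤ
  f-closed q =
    let _ , v₁ , v₂ = u-closed q
        g₀ = start q
        g₁ = trans (f-step v₁ g₀) (t (2^[q*3] q))
    in g₀ , g₁ , f-step v₂ g₁
    where
    t : ∀ p → - (+ 2) * p +ℤ + 2 * p ≡ 0ℤ
    t = solve-∀
    start : ∀ q → f (q ℕ.* 3) ≡ 2^[q*3] q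
    start zero    = f₀
    start (suc q) = trans (f-step (proj₁ (u-closed (suc q))) (proj₂ (proj₂ (f-closed q)))) (ℤ.+-identityʳ _)

  -- The forcing terms from `f` share the characteristic roots of the recurrence, and this resonance
  -- produces the linear factor `suc q`. The index is one less than the matrix size, so the cases
  -- are the sizes 3q + 2, 3q + 3 and 3q + 4.
  b-closed : ∀ q → b (1 + q ℕ.* 3) ≡ - (2^[q*3] q * + suc q)
                 × b (2 + q ℕ.* 3) ≡ 0ℤ
                 × b (3 + q ℕ.* 3) ≡ + 4 * 2^[q*3] q * + suc q
  b-closed q =
    let g₀ , g₁ , g₂ = f-closed q
        c₁ , c₂ = start q
    in c₁ , c₂ , trans (b-step c₂ c₁ g₂ g₁) (t (2^[q*3] q) (+ suc q))
    where
    t : ∀ p r → - (+ 2) * 0ℤ -ℤ + 4 * - (p * r) -ℤ 0ℤ -ℤ + 2 * 0ℤ ≡ + 4 * p * r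
    t = solve-∀
    t₁ : ∀ p r → - (+ 2) * (+ 4 * p * r) -ℤ + 4 * 0ℤ -ℤ + 8 * p -ℤ + 2 * 0ℤ ≡ - (+ 8 * p * (1ℤ +ℤ r))
    t₁ = solve-∀
    t₂ : ∀ p r → - (+ 2) * - (+ 8 * p * (1ℤ +ℤ r)) -ℤ + 4 * (+ 4 * p * r) -ℤ 0ℤ -ℤ + 2 * (+ 8 * p) ≡ 0ℤ
    t₂ = solve-∀
    start : ∀ q → b (1 + q ℕ.* 3) ≡ - (2^[q*3] q * + suc q) × b (2 + q ℕ.* 3) ≡ 0ℤ
    start zero    = b₁ , trans (b-step b₁ b₀ (proj₁ (proj₂ (f-closed 0))) f₀) refl
    start (suc q) =
      let _ , _ , g₂ = f-closed q
          h₀ , h₁ , _ = f-closed (suc q)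
          _ , c₂ , c₃ = b-closed q
          8p = 2^[q*3]-suc q
          d₁ = trans (b-step c₃ c₂ (trans h₀ 8p) g₂) (t₁ (2^[q*3] q) (+ suc q))
          d₂ = trans (b-step d₁ c₃ h₁ (trans h₀ 8p)) (t₂ (2^[q*3] q) (+ suc q))
      in trans d₁ (cong (λ x → - (x * + suc (suc q))) (sym 8p)) , d₂

open ClosedForm (λ m → det (T m)) (λ m → det (topOnes m)) (λ m → det (B (suc m)))
  det-T-rec det-topOnes-rec det-B-rec refl refl refl refl refl
  using () renaming (b-closed to det-B)

-- The residue classes modulo 3.

divMod₃ : ∀ n {r} → n % 3 ≡ r → n ≡ r + n / 3 ℕ.* 3
divMod₃ n refl = m≡m%n+[m/n]*n n 3

det-B-mod₀ : ∀ n → 5 ≤ n → n % 3 ≡ 0 → det (B n) ≡ 0ℤ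
det-B-mod₀ n 5≤n eq with n / 3 | divMod₃ n eq
... | suc q | refl = proj₁ (proj₂ (det-B q))
det-B-mod₀ n () eq | zero | refl

det-B-mod₁ : ∀ n → 5 ≤ n → n % 3 ≡ 1 → det (B n) ≡ + (2 ^ (n ∸ 2)) * + ((n ∸ 1) / 3)
det-B-mod₁ n 5≤n eq with n / 3 | divMod₃ n eq
det-B-mod₁ n (s≤s ()) eq | zero | refl
-- Here `n` is `4 + q * 3`, so the exponent is `2 + q * 3` and the quotient is `suc q`.
... | suc q | refl = trans (proj₂ (proj₂ (det-B q))) (sym (cong₂ _*_
  (trans (cong +_ (ℕ.^-distribˡ-+-* 2 2 (q ℕ.* 3))) (ℤ.pos-* 4 (2 ^ (q ℕ.* 3))))
  (cong +_ (m*n/n≡m (suc q) 3))))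

det-B-mod₂ : ∀ n → n % 3 ≡ 2 → det (B n) ≡ - (+ (2 ^ (n ∸ 2))) * + ((n + 1) / 3)
det-B-mod₂ n eq with n / 3 | divMod₃ n eq
... | q | refl = trans (proj₁ (det-B q)) (trans (ℤ.neg-distribˡ-* (2^[q*3] q) (+ suc q))
  (cong (λ x → - 2^[q*3] q * + x) (sym
    (trans (cong (_/ 3) (ℕ.+-comm (2 + q ℕ.* 3) 1)) (m*n/n≡m (suc q) 3)))))

-- Distances and eccentricities

module Distance {n} (G : SimpleGraph n) (conn : Connected G) where
  open SimpleGraph G

  -- `dist` searches below the path length supplied by `conn`; minimality makes the result
  -- independent of that path.
  dist-unique : ∀ {u v k} → Path G u v k → (∀ j → j < k → ¬ Path G u v j) → dist G conn u v ≡ k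
  dist-unique {u} {v} p shortest with least (path? G u v) _ (proj₂ (conn u v))
  ... | m , q , below = ℕ.≤-antisym (ℕ.≮⇒≥ λ k<m → below _ k<m p) (ℕ.≮⇒≥ λ m<k → shortest _ m<k q)

  dist-refl : ∀ u → dist G conn u u ≡ 0
  dist-refl u = dist-unique (nil , [] ∷ []) λ _ ()

  dist-adj : ∀ {u v} → Adj u v → dist G conn u v ≡ 1
  dist-adj uv = dist-unique (cons uv nil , ((λ eq → adj-irrefl eq uv) ∷ []) ∷ [] ∷ [])
    λ { zero _ (nil , _) → adj-irrefl refl uv ; (suc _) (s≤s ()) }

  dist-two : ∀ {u v w} → u ≢ v → ¬ Adj u v → Adj u w → Adj w v → dist G conn u v ≡ 2
  dist-two u≢v ¬uv uw wv = dist-unique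
    (cons uw (cons wv nil) ,
      ((λ eq → adj-irrefl eq uw) ∷ u≢v ∷ []) ∷ ((λ eq → adj-irrefl eq wv) ∷ []) ∷ [] ∷ [])
    λ { zero _ (nil , _) → u≢v refl
      ; (suc zero) _ (cons uv nil , _) → ¬uv uv
      ; (suc (suc _)) (s≤s (s≤s ())) }

  ecc-attained : ∀ u w {d} → (∀ v → dist G conn u v ≤ d) → dist G conn u w ≡ d → ecc G conn u ≡ d
  ecc-attained u w bound refl =
    -- The final `z≤n` bounds the default value 0 of `max`.
    Extrema.max≈v⁺ ℕ.≤-totalOrder (∈-tabulate⁺ w) (tabulate⁺ bound) z≤n

  -- Once the distance and both eccentricities are numerals, the test on the right evaluates and the
  -- entry is known by computation.
  eccMatrix-entry : ∀ u v {d x y} → dist G conn u v ≡ d → ecc G conn u ≡ x → ecc G conn v ≡ y →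
    eccMatrix G conn u v ≡ (if ⌊ d ℕ.≟ x ⊓ y ⌋ then + d else 0ℤ)
  eccMatrix-entry u v p q r = trans
    (cong₂ (λ x y → if ⌊ dist G conn u v ℕ.≟ x ⊓ y ⌋ then + dist G conn u v else 0ℤ) q r)
    (cong (λ d → if ⌊ d ℕ.≟ _ ⌋ then + d else 0ℤ) p)

-- Rotating the rim

rotateBy : ∀ {k} → ℕ → Fin (suc k) → Fin (suc k)
rotateBy zero    = id
rotateBy (suc t) = rotate ∘ rotateBy t

det-conjugateRotateBy : ∀ {k} t (A : Matrix (suc (suc k))) →
  det (λ i j → A (lift₀ (rotateBy t) i) (lift₀ (rotateBy t) j)) ≡ det A
det-conjugateRotateBy zero A = det-cong λ i j → cong₂ A (lift₀-id i) (lift₀-id j)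
  where
  lift₀-id : ∀ {n} (i : Fin (suc n)) → lift₀ id i ≡ i
  lift₀-id zero    = refl
  lift₀-id (suc i) = refl
det-conjugateRotateBy (suc t) A = begin
  det (λ i j → A (lift₀ (rotateBy (suc t)) i) (lift₀ (rotateBy (suc t)) j))
    ≡⟨ det-cong (λ i j → cong₂ A (lift₀-∘ i) (lift₀-∘ j)) ⟩
  det (λ i j → A′ (lift₀ (rotateBy t) i) (lift₀ (rotateBy t) j))
    ≡⟨ det-conjugateRotateBy t A′ ⟩
  det A′
    ≡⟨ det-conjugateRotation A ⟩
  det A ∎
  where
  A′ : Matrix _
  A′ i j = A (lift₀ rotate i) (lift₀ rotate j)
  lift₀-∘ : ∀ i → lift₀ (rotateBy (suc t)) i ≡ lift₀ rotate (lift₀ (rotateBy t) i)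
  lift₀-∘ zero    = refl
  lift₀-∘ (suc i) = refl

rotate-injective : ∀ {k} {i j : Fin (suc k)} → rotate i ≡ rotate j → i ≡ j
rotate-injective {i = zero}  {zero}  _  = refl
rotate-injective {i = zero}  {suc j} eq = ⊥-elim (fromℕ≢inject₁ eq)
rotate-injective {i = suc i} {zero}  eq = ⊥-elim (fromℕ≢inject₁ (sym eq))
rotate-injective {i = suc i} {suc j} eq = cong suc (inject₁-injective eq)

rotateBy-injective : ∀ {k} t {i j : Fin (suc k)} → rotateBy t i ≡ rotateBy t j → i ≡ j
rotateBy-injective zero    eq = eq
rotateBy-injective (suc t) eq = rotateBy-injective t (rotate-injective eq)

-- Each rotation lowers a nonzero position by one, so a start at `t + s` does not wrap around within
-- `t` steps.
toℕ-rotateBy : ∀ {k} t {s} {i : Fin (suc k)} → toℕ i ≡ t + s → toℕ (rotateBy t i) ≡ s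
toℕ-rotateBy zero eq = eq
toℕ-rotateBy (suc t) {s} {i} eq = back (toℕ-rotateBy t (trans eq (sym (ℕ.+-suc t s))))
  where
  back : ∀ {k s} {i : Fin (suc k)} → toℕ i ≡ suc s → toℕ (rotate i) ≡ s
  back {i = suc i} eq = trans (toℕ-inject₁ i) (ℕ.suc-injective eq)

-- The shift is an automorphism of the directed cycle; an arc can change its disjunct of `Next` when
-- an endpoint passes from 0 to the last position.
next-rotate⁺ : ∀ {k} (i j : Fin (suc k)) → Next i j → Next (rotate i) (rotate j)
next-rotate⁺ zero zero (inj₂ (refl , _)) = inj₂ (refl , refl)
next-rotate⁺ {k} zero (suc j) (inj₁ eq) = inj₂
  (cong suc (toℕ-fromℕ k) , trans (toℕ-inject₁ j) (sym (ℕ.suc-injective eq)))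
next-rotate⁺ {k} (suc i) zero (inj₂ (eq , _)) = inj₁
  (trans (cong suc (toℕ-inject₁ i)) (trans (ℕ.suc-injective eq) (sym (toℕ-fromℕ k))))
next-rotate⁺ (suc i) (suc j) (inj₁ eq) = inj₁
  (trans (cong suc (toℕ-inject₁ i)) (trans (ℕ.suc-injective eq) (sym (toℕ-inject₁ j))))

next-rotate⁻ : ∀ {k} (i j : Fin (suc k)) → Next (rotate i) (rotate j) → Next i j
next-rotate⁻ {k} zero zero nxt rewrite toℕ-fromℕ k with nxt
... | inj₁ eq = ⊥-elim (ℕ.1+n≢n eq)
... | inj₂ (_ , refl) = inj₂ (refl , refl)
next-rotate⁻ {k} zero (suc j) nxt rewrite toℕ-fromℕ k | toℕ-inject₁ j with nxt
... | inj₁ eq = ⊥-elim (ℕ.<⇒≢ (ℕ.m<n⇒m<1+n (toℕ<n j)) (sym eq))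
... | inj₂ (_ , eq) = inj₁ (cong suc (sym eq))
next-rotate⁻ {k} (suc i) zero nxt rewrite toℕ-fromℕ k | toℕ-inject₁ i with nxt
... | inj₁ eq = inj₂ (cong suc eq , refl)
... | inj₂ (eq , _) = ⊥-elim (ℕ.<⇒≢ (s≤s (toℕ<n i)) eq)
next-rotate⁻ (suc i) (suc j) nxt rewrite toℕ-inject₁ i | toℕ-inject₁ j with nxt
... | inj₁ eq = inj₁ (cong suc eq)
... | inj₂ (eq , _) = ⊥-elim (ℕ.<⇒≢ (s≤s (toℕ<n i)) eq)

next-rotateBy⁺ : ∀ {k} t (i j : Fin (suc k)) → Next i j → Next (rotateBy t i) (rotateBy t j)
next-rotateBy⁺ zero    i j = id
next-rotateBy⁺ (suc t) i j = next-rotate⁺ (rotateBy t i) (rotateBy t j) ∘ next-rotateBy⁺ t i j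

next-rotateBy⁻ : ∀ {k} t (i j : Fin (suc k)) → Next (rotateBy t i) (rotateBy t j) → Next i j
next-rotateBy⁻ zero    i j = id
next-rotateBy⁻ (suc t) i j = next-rotateBy⁻ t i j ∘ next-rotate⁻ (rotateBy t i) (rotateBy t j)

-- The rim without the deleted edge, straightened to a path.

RimAdj : ∀ {m} → (a b i j : Fin m) → Set
RimAdj {m} a b i j = SimpleGraph.Adj (wheel-e (suc m) (suc a) (suc b)) (suc i) (suc j)

rimAdj-sym : ∀ {m} (a b : Fin m) {i j} → RimAdj a b i j → RimAdj a b j i
rimAdj-sym {m} a b {i} {j} = SimpleGraph.adj-sym (wheel-e (suc m) (suc a) (suc b)) {suc i} {suc j}

rimAdj-flip : ∀ {m} (a b : Fin m) {i j} → RimAdj a b i j → RimAdj b a i j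
rimAdj-flip a b (ij , ne) = ij , ne ∘ swap

Near : ∀ {m} → Fin m → Fin m → Set
Near i j = ∣ toℕ i - toℕ j ∣ ≤ 1

∣m-n∣≤1⇒ : ∀ m n → ∣ m - n ∣ ≤ 1 → m ≡ n ⊎ suc m ≡ n ⊎ suc n ≡ m
∣m-n∣≤1⇒ zero          zero          _        = inj₁ refl
∣m-n∣≤1⇒ zero          (suc zero)    _        = inj₂ (inj₁ refl)
∣m-n∣≤1⇒ zero          (suc (suc _)) (s≤s ())
∣m-n∣≤1⇒ (suc zero)    zero          _        = inj₂ (inj₂ refl)
∣m-n∣≤1⇒ (suc (suc _)) zero          (s≤s ())
∣m-n∣≤1⇒ (suc m)       (suc n)       le       =
  Sum.map (cong suc) (Sum.map (cong suc) (cong suc)) (∣m-n∣≤1⇒ m n le)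

∣n-1+n∣≤1 : ∀ n → ∣ n - suc n ∣ ≤ 1
∣n-1+n∣≤1 zero    = s≤s z≤n
∣n-1+n∣≤1 (suc n) = ∣n-1+n∣≤1 n

-- Rotating by b sends b to 0 and a to the last position, so that the rim without
-- the edge a → b becomes the path 0, 1, 2, ….
module CutCycle {k} (a b : Fin (3 + k)) (a→b : Next a b) where

  ρ : Fin (3 + k) → Fin (3 + k)
  ρ = rotateBy (toℕ b)

  ρ-injective : ∀ {i j} → toℕ (ρ i) ≡ toℕ (ρ j) → i ≡ j
  ρ-injective eq = rotateBy-injective (toℕ b) (toℕ-injective eq)

  ρb≡0 : toℕ (ρ b) ≡ 0
  ρb≡0 = toℕ-rotateBy (toℕ b) (sym (ℕ.+-identityʳ (toℕ b)))

  1+ρa≡m : suc (toℕ (ρ a)) ≡ 3 + k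
  1+ρa≡m with next-rotateBy⁺ (toℕ b) a b a→b
  ... | inj₁ eq       = ⊥-elim (ℕ.1+n≢0 (trans eq ρb≡0))
  ... | inj₂ (eq , _) = eq

  successive⇒rimAdj : ∀ i j → suc (toℕ (ρ i)) ≡ toℕ (ρ j) → RimAdj a b i j
  successive⇒rimAdj i j eq =
    ( (λ i≡j → ℕ.1+n≢n (trans eq (cong (toℕ ∘ ρ) (sym i≡j))))
    , inj₁ (next-rotateBy⁻ (toℕ b) i j (inj₁ eq)) ) ,
    λ { (inj₁ (_ , refl)) → ℕ.1+n≢0 (trans eq ρb≡0)
      -- The reversed edge would make position 1 the last one, so the rim would have only two
      -- vertices.
      ; (inj₂ (refl , refl)) → 2≢3+ (trans (cong (ℕ.suc ∘ ℕ.suc) (sym ρb≡0))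
                                      (trans (cong suc eq) 1+ρa≡m)) }
    where
    2≢3+ : 2 ≢ 3 + k
    2≢3+ ()

  near⇒ : ∀ i j → Near (ρ i) (ρ j) → i ≡ j ⊎ RimAdj a b i j
  near⇒ i j near with ∣m-n∣≤1⇒ (toℕ (ρ i)) (toℕ (ρ j)) near
  ... | inj₁ eq        = inj₁ (ρ-injective eq)
  ... | inj₂ (inj₁ eq) = inj₂ (successive⇒rimAdj i j eq)
  ... | inj₂ (inj₂ eq) = inj₂ (rimAdj-sym a b (successive⇒rimAdj j i eq))

  next⇒near : ∀ i j → Next i j → ¬ (i ≡ a × j ≡ b) → Near (ρ i) (ρ j)
  next⇒near i j i→j ij≢ab with next-rotateBy⁺ (toℕ b) i j i→j
  ... | inj₁ eq = subst (λ d → ∣ toℕ (ρ i) - d ∣ ≤ 1) eq (∣n-1+n∣≤1 (toℕ (ρ i)))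
  -- A wrapping arc runs from the last position to 0, so injectivity identifies it as the deleted
  -- one.
  ... | inj₂ (eq , eq′) = ⊥-elim (ij≢ab
    ( ρ-injective (ℕ.suc-injective (trans eq (sym 1+ρa≡m)))
    , ρ-injective (trans eq′ (sym ρb≡0)) ))

  ⇒near : ∀ i j → i ≡ j ⊎ RimAdj a b i j → Near (ρ i) (ρ j)
  ⇒near i j (inj₁ refl) = subst (_≤ 1) (sym (ℕ.∣n-n∣≡0 (toℕ (ρ i)))) z≤n
  ⇒near i j (inj₂ ((_ , inj₁ i→j) , ne)) = next⇒near i j i→j
    λ (p , q) → ne (inj₁ (cong suc p , cong suc q))
  ⇒near i j (inj₂ ((_ , inj₂ j→i) , ne)) = subst (_≤ 1) (ℕ.∣-∣-comm (toℕ (ρ j)) (toℕ (ρ i)))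
    (next⇒near j i j→i λ (p , q) → ne (inj₂ (cong suc q , cong suc p)))

-- The deleted edge is an arc of the directed cycle in one of its two orientations; the rotation is
-- by the head of that arc.
straighten : ∀ {k} (a b : Fin (3 + k)) → CycleAdj a b → ∃ λ t → ∀ i j →
  (Near (rotateBy t i) (rotateBy t j) → i ≡ j ⊎ RimAdj a b i j) ×
  (i ≡ j ⊎ RimAdj a b i j → Near (rotateBy t i) (rotateBy t j))
straighten a b (_ , inj₁ a→b) = toℕ b , λ i j → near⇒ i j , ⇒near i j
  where open CutCycle a b a→b
straighten a b (_ , inj₂ b→a) = toℕ a , λ i j →
  Sum.map₂ (rimAdj-flip b a) ∘ near⇒ i j , ⇒near i j ∘ Sum.map₂ (rimAdj-flip a b)
  where open CutCycle b a b→a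

-- The witness lies two positions away, which is not adjacent on a cycle of length at least four;
-- for the eccentricities, this is where n ≥ 5 enters.
nonadjacent : ∀ {k} (i : Fin (4 + k)) → ∃ λ j → i ≢ j × ¬ CycleAdj i j
nonadjacent zero = suc (suc zero) , (λ ()) , λ
  { (_ , inj₁ (inj₁ ())) ; (_ , inj₁ (inj₂ ())) ; (_ , inj₂ (inj₁ ())) ; (_ , inj₂ (inj₂ ())) }
nonadjacent (suc zero) = suc (suc (suc zero)) , (λ ()) , λ
  { (_ , inj₁ (inj₁ ())) ; (_ , inj₁ (inj₂ ())) ; (_ , inj₂ (inj₁ ())) ; (_ , inj₂ (inj₂ ())) }
nonadjacent {k} (suc (suc i)) = j , i≢j , λ
  { (_ , inj₁ (inj₁ eq)) → ℕ.m+1+n≢n 2 (trans eq j≡i)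
  -- Wrapping around to `j` at 0 would make position 2 the last one, on a rim of length 3.
  ; (_ , inj₁ (inj₂ (eq , j≡0))) → 3≢4+ (trans (cong (ℕ.suc ∘ ℕ.suc ∘ ℕ.suc) (trans (sym j≡0) j≡i)) eq)
  ; (_ , inj₂ (inj₁ eq)) → ℕ.1+n≢n (sym (trans (sym j≡i) (ℕ.suc-injective eq)))
  ; (_ , inj₂ (inj₂ ())) }
  where
  j : Fin (4 + k)
  j = inject₁ (inject₁ i)
  j≡i : toℕ j ≡ toℕ i
  j≡i = trans (toℕ-inject₁ (inject₁ i)) (toℕ-inject₁ i)
  i≢j : suc (suc i) ≢ j
  i≢j eq = ℕ.m+1+n≢n 1 (trans (cong toℕ eq) j≡i)
  3≢4+ : 3 ≢ 4 + k
  3≢4+ ()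

T-near : ∀ {m} (i j : Fin m) → Near i j → T m i j ≡ - (+ 2)
T-near i j near = cong (if_then - (+ 2) else 0ℤ) (trans (isYes≗does d?) (dec-true d? near))
  where d? = ∣ toℕ i - toℕ j ∣ ℕ.≤? 1

T-far : ∀ {m} (i j : Fin m) → ¬ Near i j → T m i j ≡ 0ℤ
T-far i j far = cong (if_then - (+ 2) else 0ℤ) (trans (isYes≗does d?) (dec-false d? far))
  where d? = ∣ toℕ i - toℕ j ∣ ℕ.≤? 1

-- The eccentricity matrix of a graph with a dominating vertex

-- From here on the sizes under det are written with suc and not as numerals:
-- unless both sides are syntactically equal, conversion unfolds det completely.
module Cone {k} (G : SimpleGraph (suc (suc k))) (conn : Connected G)
  (hub-rim : ∀ i → SimpleGraph.Adj G zero (suc i))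
  (nonneighbour : ∀ i → ∃ λ j → i ≢ j × ¬ SimpleGraph.Adj G (suc i) (suc j))
  where

  open SimpleGraph G
  open Distance G conn

  Close : Fin (suc k) → Fin (suc k) → Set
  Close i j = i ≡ j ⊎ Adj (suc i) (suc j)

  rim-hub : ∀ i → Adj (suc i) zero
  rim-hub i = adj-sym (hub-rim i)

  dist-far : ∀ i j → ¬ Close i j → dist G conn (suc i) (suc j) ≡ 2
  dist-far i j far = dist-two {w = zero} (far ∘ inj₁ ∘ suc-injective) (far ∘ inj₂) (rim-hub i) (hub-rim j)

  dist-near : ∀ i j → Close i j → dist G conn (suc i) (suc j) ≡ 0 ⊎ dist G conn (suc i) (suc j) ≡ 1
  dist-near i j (inj₁ refl) = inj₁ (dist-refl (suc i))
  dist-near i j (inj₂ adj)  = inj₂ (dist-adj adj)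

  ecc-hub : ecc G conn zero ≡ 1
  ecc-hub = ecc-attained zero (suc zero)
    (λ { zero → ℕ.≤-trans (ℕ.≤-reflexive (dist-refl zero)) z≤n
       ; (suc i) → ℕ.≤-reflexive (dist-adj (hub-rim i)) })
    (dist-adj (hub-rim zero))

  ecc-rim : ∀ i → ecc G conn (suc i) ≡ 2
  ecc-rim i = let w , i≢w , ¬iw = nonneighbour i in
    ecc-attained (suc i) (suc w) bound (dist-far i w [ i≢w , ¬iw ]′)
    where
    bound-rim : ∀ j → Dec (Close i j) → dist G conn (suc i) (suc j) ≤ 2
    bound-rim j (no far)    = ℕ.≤-reflexive (dist-far i j far)
    bound-rim j (yes close) =
      [ (λ eq → subst (_≤ 2) (sym eq) z≤n) , (λ eq → subst (_≤ 2) (sym eq) (s≤s z≤n)) ]′ (dist-near i j close)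
    bound : ∀ v → dist G conn (suc i) v ≤ 2
    bound zero    = subst (_≤ 2) (sym (dist-adj (rim-hub i))) (s≤s z≤n)
    bound (suc j) = bound-rim j ((i ≟ j) ⊎-dec adj? (suc i) (suc j))

  -- Distances 0 and 1 both fall short of the common eccentricity 2 of rim vertices.
  eccMatrix-near : ∀ i j → Close i j → eccMatrix G conn (suc i) (suc j) ≡ 0ℤ
  eccMatrix-near i j close = [ case 0 refl , case 1 refl ]′ (dist-near i j close)
    where
    case : ∀ d → (if ⌊ d ℕ.≟ 2 ⌋ then + d else 0ℤ) ≡ 0ℤ →
           dist G conn (suc i) (suc j) ≡ d → eccMatrix G conn (suc i) (suc j) ≡ 0ℤ
    case d zero-entry eq = trans (eccMatrix-entry (suc i) (suc j) eq (ecc-rim i) (ecc-rim j)) zero-entry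

  eccMatrix-far : ∀ i j → ¬ Close i j → eccMatrix G conn (suc i) (suc j) ≡ + 2
  eccMatrix-far i j far = eccMatrix-entry (suc i) (suc j) (dist-far i j far) (ecc-rim i) (ecc-rim j)

  eccMatrix-hub : eccMatrix G conn zero zero ≡ 0ℤ
  eccMatrix-hub = eccMatrix-entry zero zero (dist-refl zero) ecc-hub ecc-hub

  -- The test uses the smaller eccentricity, here the 1 of the hub, so spokes keep their distance as
  -- entry.
  eccMatrix-hub-rim : ∀ j → eccMatrix G conn zero (suc j) ≡ + 1
  eccMatrix-hub-rim j = eccMatrix-entry zero (suc j) (dist-adj (hub-rim j)) ecc-hub (ecc-rim j)

  eccMatrix-rim-hub : ∀ i → eccMatrix G conn (suc i) zero ≡ + 1
  eccMatrix-rim-hub i = eccMatrix-entry (suc i) zero (dist-adj (rim-hub i)) (ecc-rim i) ecc-hub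

  det-eccMatrix : ∀ t →
    (∀ i j → (Near (rotateBy t i) (rotateBy t j) → Close i j) ×
             (Close i j → Near (rotateBy t i) (rotateBy t j))) →
    det (eccMatrix G conn) ≡ det (B (suc (suc k)))
  det-eccMatrix t near⇔ = begin
    det E
      ≡⟨ det-addFirstRow (λ _ → - (+ 2)) E ⟨
    det E′
      ≡⟨ det-cong {A = E′} {λ i j → B (suc (suc k)) (lift₀ σ i) (lift₀ σ j)} entry ⟩
    det (λ i j → B (suc (suc k)) (lift₀ σ i) (lift₀ σ j))
      ≡⟨ det-conjugateRotateBy t (B (suc (suc k))) ⟩
    det (B (suc (suc k))) ∎
    where
    σ : Fin (suc k) → Fin (suc k)
    σ = rotateBy t
    E E′ : Matrix (suc (suc k))
    E  = eccMatrix G conn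
    E′ = addFirstRow (λ _ → - (+ 2)) E
    reduce : ∀ i j {x y} → E i j ≡ x → E zero j ≡ y → E i j +ℤ - (+ 2) * E zero j ≡ x +ℤ - (+ 2) * y
    reduce i j = cong₂ (λ x y → x +ℤ - (+ 2) * y)
    rim-entry : ∀ i j → Dec (Near (σ i) (σ j)) → E′ (suc i) (suc j) ≡ T (suc k) (σ i) (σ j)
    rim-entry i j (yes near) = trans
      (reduce (suc i) (suc j) (eccMatrix-near i j (proj₁ (near⇔ i j) near)) (eccMatrix-hub-rim j))
      (sym (T-near (σ i) (σ j) near))
    rim-entry i j (no far) = trans
      (reduce (suc i) (suc j) (eccMatrix-far i j (far ∘ proj₂ (near⇔ i j))) (eccMatrix-hub-rim j))
      (sym (T-far (σ i) (σ j) far))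
    entry : ∀ i j → E′ i j ≡ B (suc (suc k)) (lift₀ σ i) (lift₀ σ j)
    entry zero    zero    = eccMatrix-hub
    entry zero    (suc j) = eccMatrix-hub-rim j
    -- The hub row starts with 0, so the row operation leaves the border column of ones intact.
    entry (suc i) zero    = reduce (suc i) zero (eccMatrix-rim-hub i) eccMatrix-hub
    entry (suc i) (suc j) = rim-entry i j (∣ toℕ (σ i) - toℕ (σ j) ∣ ℕ.≤? 1)

-- The wheel with a rim edge deleted.

det-eccMatrix-cutWheel : ∀ k (a b : Fin (suc (suc (suc (suc k))))) → CycleAdj a b →
  (conn : Connected (wheel-e (suc (suc (suc (suc (suc k))))) (suc a) (suc b))) →
  det (eccMatrix (wheel-e (suc (suc (suc (suc (suc k))))) (suc a) (suc b)) conn)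
    ≡ det (B (suc (suc (suc (suc (suc k))))))
det-eccMatrix-cutWheel k a b ab conn =
  Cone.det-eccMatrix {suc (suc (suc k))} (wheel-e (suc (suc (suc (suc (suc k))))) (suc a) (suc b)) conn
    (λ _ → tt , λ { (inj₁ ()) ; (inj₂ ()) })
    -- A non-neighbour on the full rim remains one after the deletion.
    (λ i → let j , i≢j , ¬ij = nonadjacent i in j , i≢j , ¬ij ∘ proj₁)
    (proj₁ (straighten a b ab)) (proj₂ (straighten a b ab))

det-eccMatrix≡det-B : ∀ n → 5 ≤ n → (a b : Fin n) (e : RimEdge a b) →
  det (eccMatrix (wheel-e n a b) (wheel-e-connected a b e)) ≡ det (B n)
det-eccMatrix≡det-B (suc (suc (suc (suc (suc k))))) _ (suc a) (suc b) e =
  det-eccMatrix-cutWheel k a b e (wheel-e-connected {suc (suc (suc (suc (suc k))))} (suc a) (suc b) e)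
det-eccMatrix≡det-B 1 (s≤s ())
det-eccMatrix≡det-B 2 (s≤s (s≤s ()))
det-eccMatrix≡det-B 3 (s≤s (s≤s (s≤s ())))
det-eccMatrix≡det-B 4 (s≤s (s≤s (s≤s (s≤s ()))))

mainTheorem11 : (n : ℕ) → 5 ≤ n → (a b : Fin n) (e : RimEdge a b) →
    det (eccMatrix (wheel-e n a b) (wheel-e-connected a b e)) ≡ det (B n)
    × (n % 3 ≡ 0 → det (B n) ≡ 0ℤ)
    × (n % 3 ≡ 1 → det (B n) ≡ + (2 ^ (n ∸ 2)) * + ((n ∸ 1) / 3))
    × (n % 3 ≡ 2 → det (B n) ≡ - (+ (2 ^ (n ∸ 2))) * + ((n + 1) / 3))
mainTheorem11 n 5≤n a b e =
  det-eccMatrix≡det-B n 5≤n a b e , det-B-mod₀ n 5≤n , det-B-mod₁ n 5≤n , det-B-mod₂ n
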